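{- For all integers $n>0$ and $R\ge 0$, $k^+[n,R]=k^{\pm}[n,R]=k^-[n,R]=\max\{1,n-R\}$.
   Context: $Q_n=\{0,1\}^n$ is identified with the vector space $\mathbb{F}_2^n$ and is ordered by $x\preceq y$ iff $x_i\le y_i$ for all $i$; $d(x,y)$ is the Hamming distance and $\hat 1=(1,\dots,1)$. The downward directed ball is $B_n^-(x,R)=\{y\in Q_n: y\preceq x,\ d(x,y)\le R\}$. A set $\mathcal{C}\subseteq Q_n$ downward $R$-covers $Q_n$ if $Q_n=\bigcup_{c\in\mathcal{C}}B_n^-(c,R)$. The 1's complement of $\mathcal{C}$ is $\bar{\mathcal{C}}=\{\hat 1-x: x\in\mathcal{C}\}$. An $[n,R]^+$-code is a vector subspace $\mathcal{C}$ of $\mathbb{F}_2^n$ that downward $R$-covers $Q_n$. An $[n,R]^-$-code is a set $\mathcal{C}\subseteq Q_n$ whose 1's complement $\bar{\mathcal{C}}$ is an $[n,R]^+$-code. (Any downward covering set contains $\hat 1$, so such a $\mathcal{C}$ is again a subspace and its dimension makes sense.) An $[n,R]^{\pm}$-code is an $[n,R]^+$-code $\mathcal{C}$ that is self-complementary, i.e. $\mathcal{C}=\bar{\mathcal{C}}$. $k^+[n,R]$, $k^-[n,R]$, $k^{\pm}[n,R]$ denote the minimum dimension of an $[n,R]^+$-code, an $[n,R]^-$-code, and an $[n,R]^{\pm}$-code, respectively. -}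

module Defs where

open import Data.Bool.Base using (Bool; true; false; _∧_; _xor_) renaming (_≤_ to _≤ᵇ_)
open import Data.Bool.Properties using (_≟_)
open import Data.Nat.Base using (ℕ; _≤_)
open import Data.Product.Base using (Σ-syntax; ∃; ∃-syntax; _×_; _,_; uncurry)
open import Data.Vec.Base using (Vec; []; _∷_; map; zip; zipWith; replicate; count)
open import Data.Vec.Relation.Binary.Pointwise.Inductive using (Pointwise)
open import Level using (0ℓ)
open import Relation.Binary.PropositionalEquality.Core using (_≡_; _≢_)
open import Relation.Nullary.Decidable using (¬?)
open import Relation.Unary using (Pred; Decidable; _∈_; _≐_; U; ⋃)

-- 𝔽₂ is Bool with _xor_ as addition and _∧_ as multiplication.
Q : ℕ → Set
Q n = Vec Bool n

𝟎 𝟏 : ∀ {n} → Q n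
𝟎 = replicate _ false
𝟏 = replicate _ true

infixl 6 _⊕_
infixr 7 _·_

_⊕_ : ∀ {n} → Q n → Q n → Q n
_⊕_ = zipWith _xor_

_·_ : ∀ {n} → Bool → Q n → Q n
a · x = map (a ∧_) x

infix 4 _≼_

_≼_ : ∀ {n} → Q n → Q n → Set
_≼_ = Pointwise _≤ᵇ_

differ? : Decidable (uncurry (_≢_ {A = Bool}))
differ? (a , b) = ¬? (a ≟ b)

hamming : ∀ {n} → Q n → Q n → ℕ
hamming x y = count differ? (zip x y)

Subset : ℕ → Set₁
Subset n = Pred (Q n) 0ℓ

B⁻ : ∀ {n} → Q n → ℕ → Subset n
B⁻ x R y = y ≼ x × hamming x y ≤ R

DownwardCovers : ∀ {n} → ℕ → Subset n → Set
DownwardCovers {n} R C = U ≐ ⋃ (∃ C) (λ (c , _) → B⁻ c R)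

-- In characteristic 2 the difference 𝟏 - x is 𝟏 ⊕ x.
complement : ∀ {n} → Subset n → Subset n
complement C y = ∃[ x ] x ∈ C × y ≡ 𝟏 ⊕ x

record IsSubspace {n} (C : Subset n) : Set where
  field
    𝟎-mem    : 𝟎 ∈ C
    ⊕-closed : ∀ {x y} → x ∈ C → y ∈ C → x ⊕ y ∈ C
    ·-closed : ∀ a {x} → x ∈ C → a · x ∈ C

linComb : ∀ {n k} → Vec Bool k → Vec (Q n) k → Q n
linComb []       []       = 𝟎
linComb (a ∷ as) (b ∷ bs) = a · b ⊕ linComb as bs

LinearlyIndependent : ∀ {n k} → Vec (Q n) k → Set
LinearlyIndependent bs = ∀ as → linComb as bs ≡ 𝟎 → as ≡ 𝟎

Span : ∀ {n k} → Vec (Q n) k → Subset n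
Span bs x = ∃[ as ] x ≡ linComb as bs

HasDimension : ∀ {n} → Subset n → ℕ → Set
HasDimension {n} C k = Σ[ bs ∈ Vec (Q n) k ] LinearlyIndependent bs × C ≐ Span bs

IsPlusCode : ∀ n → ℕ → Subset n → Set
IsPlusCode n R C = IsSubspace C × DownwardCovers R C

IsMinusCode : ∀ n → ℕ → Subset n → Set
IsMinusCode n R C = IsPlusCode n R (complement C)

IsPlusMinusCode : ∀ n → ℕ → Subset n → Set
IsPlusMinusCode n R C = IsPlusCode n R C × C ≐ complement C

-- A minimum is a relation rather than a function ℕ → ℕ → ℕ: it asserts that
-- the minimum is attained, and antisymmetry of _≤_ makes its value unique.
IsMinimumDimension : ∀ {n} → (Subset n → Set) → ℕ → Set₁
IsMinimumDimension Code m =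
  (∃[ C ] Code C × HasDimension C m) ×
  (∀ C k → Code C → HasDimension C k → m ≤ k)

infix 4 k⁺[_,_]≡_ k⁻[_,_]≡_ k±[_,_]≡_

k⁺[_,_]≡_ k⁻[_,_]≡_ k±[_,_]≡_ : ℕ → ℕ → ℕ → Set₁
k⁺[ n , R ]≡ m = IsMinimumDimension (IsPlusCode n R) m
k⁻[ n , R ]≡ m = IsMinimumDimension (IsMinusCode n R) m
k±[ n , R ]≡ m = IsMinimumDimension (IsPlusMinusCode n R) m

{-# OPTIONS --safe #-}

-- Lower bound: Gaussian elimination gives, for a span C of k vectors, a set I of
-- at most k coordinates such that 𝟎 is the only codeword vanishing on I.  View I
-- as a vertex of the cube.  A codeword c above I makes 𝟏 ⊕ c vanish on I, so
-- c ≡ 𝟏 is the only codeword that can cover I, and its distance n - |I| from I is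
-- at most R.  Upper bound: append to all of 𝔽₂ᵖ a repetition code of length at
-- most R + 1.  Finally, a downward covering subspace contains 𝟏, hence equals its
-- complement, so the three kinds of code coincide.
module Submission where

open import Defs
open import Algebra.Bundles using (AbelianGroup)
import Algebra.Properties.CommutativeSemigroup as CommutativeSemigroupProperties
import Algebra.Properties.Group as GroupProperties
open import Data.Bool.Base using (Bool; true; false; _∧_; _xor_; f≤t; b≤b)
open import Data.Bool.Properties
  using (≤-refl; xor-assoc; xor-comm; xor-identityˡ; xor-identityʳ; xor-same)
open import Data.Fin.Base using (Fin)
open import Data.Fin.Subset using (⁅_⁆; ∣_∣; _∪_) renaming (_∈_ to _∈ᶠ_; ⊥ to ∅)
open import Data.Fin.Subset.Properties
  using (nonempty?; Empty-unique; p⊆p∪q; q⊆p∪q; x∈⁅x⁆; x∈⁅y⁆⇒x≡y; ∣⁅x⁆∣≡1; ∣⊥∣≡0; p⊆q⇒∣p∣≤∣q∣)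
open import Data.Nat.Base
  using (ℕ; zero; suc; _+_; _∸_; _⊔_; _≤_; _<_; _>_; z≤n; s≤s; s≤s⁻¹)
open import Data.Nat.Properties as ℕ using (module ≤-Reasoning)
open import Data.Product.Base using (∃-syntax; _×_; _,_; proj₁)
open import Data.Unit.Base using (tt)
open import Data.Vec.Base using (Vec; []; _∷_; map; replicate; lookup; here; there)
open import Data.Vec.Properties
  using ( zipWith-assoc; zipWith-comm; zipWith-identityˡ; zipWith-identityʳ; zipWith-replicate
        ; map-id; map-const; lookup-zipWith; []=⇒lookup; ∷-injectiveˡ; ∷-injectiveʳ)
open import Data.Vec.Relation.Binary.Pointwise.Inductive as Pointwise using ([]; _∷_)
open import Function.Base using (_∘_; id)
open import Level using (0ℓ)
open import Relation.Binary.PropositionalEquality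
open import Relation.Binary.PropositionalEquality.Algebra using (isMagma)
open import Relation.Nullary.Decidable using (yes; no)
open import Relation.Unary using (_∈_; _⊆_; _≐_)
open import Relation.Unary.Properties using (≐-trans)

private variable
  m n k r R : ℕ
  C D : Subset n

-- Linear algebra over 𝔽₂

-- Bundled so that generic group lemmas (interchange, uniqueness of inverses) apply to `_⊕_`;
-- negation is `id` because the characteristic is 2.
⊕-abelianGroup : ℕ → AbelianGroup 0ℓ 0ℓ
⊕-abelianGroup n = record
  { Carrier = Q n
  ; _≈_     = _≡_
  ; _∙_     = _⊕_
  ; ε       = 𝟎
  ; _⁻¹     = id
  ; isAbelianGroup = record
    { isGroup = record
      { isMonoid = record
        { isSemigroup = record
          { isMagma = isMagma _⊕_
          ; assoc   = zipWith-assoc xor-assoc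
          }
        ; identity = zipWith-identityˡ xor-identityˡ , zipWith-identityʳ xor-identityʳ
        }
      ; inverse = self-inverse , self-inverse
      ; ⁻¹-cong = id
      }
    ; comm = zipWith-comm xor-comm
    }
  }
  where
  self-inverse : (x : Q m) → x ⊕ x ≡ 𝟎
  self-inverse []      = refl
  self-inverse (a ∷ x) = cong₂ _∷_ (xor-same a) (self-inverse x)

module _ {n : ℕ} where
  open AbelianGroup (⊕-abelianGroup n) public
    using () renaming
      ( assoc to ⊕-assoc; identityˡ to ⊕-identityˡ; identityʳ to ⊕-identityʳ
      ; inverseʳ to ⊕-self)
  open CommutativeSemigroupProperties
    (AbelianGroup.commutativeSemigroup (⊕-abelianGroup n)) public
    using () renaming (interchange to ⊕-interchange)
  open GroupProperties (AbelianGroup.group (⊕-abelianGroup n)) public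
    using () renaming
      ( inverseʳ-unique to x⊕y≡𝟎⇒y≡x; identityˡ-unique to x⊕y≡y⇒x≡𝟎)

⊕-cancel : (x y : Q n) → x ⊕ (x ⊕ y) ≡ y
⊕-cancel x y = begin
  x ⊕ (x ⊕ y)  ≡⟨ ⊕-assoc x x y ⟨
  (x ⊕ x) ⊕ y  ≡⟨ cong (_⊕ y) (⊕-self x) ⟩
  𝟎 ⊕ y        ≡⟨ ⊕-identityˡ y ⟩
  y            ∎
  where open ≡-Reasoning

true·x≡x : (x : Q n) → true · x ≡ x
true·x≡x = map-id

false·x≡𝟎 : (x : Q n) → false · x ≡ 𝟎
false·x≡𝟎 x = map-const x false

·-zeroʳ : ∀ a → a · 𝟎 {n} ≡ 𝟎
·-zeroʳ true  = true·x≡x 𝟎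
·-zeroʳ false = false·x≡𝟎 𝟎

·-distribʳ-xor : (x : Q n) → ∀ a b → (a xor b) · x ≡ a · x ⊕ b · x
·-distribʳ-xor x false b = begin
  b · x              ≡⟨ ⊕-identityˡ (b · x) ⟨
  𝟎 ⊕ b · x          ≡⟨ cong (_⊕ b · x) (false·x≡𝟎 x) ⟨
  false · x ⊕ b · x  ∎
  where open ≡-Reasoning
·-distribʳ-xor x true false = begin
  true · x              ≡⟨ ⊕-identityʳ (true · x) ⟨
  true · x ⊕ 𝟎          ≡⟨ cong (true · x ⊕_) (false·x≡𝟎 x) ⟨
  true · x ⊕ false · x  ∎
  where open ≡-Reasoning
·-distribʳ-xor x true true = trans (false·x≡𝟎 x) (sym (⊕-self (true · x)))

linComb-𝟎 : (bs : Vec (Q n) k) → linComb 𝟎 bs ≡ 𝟎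
linComb-𝟎 []       = refl
linComb-𝟎 (b ∷ bs) = trans (cong₂ _⊕_ (false·x≡𝟎 b) (linComb-𝟎 bs)) (⊕-self 𝟎)

linComb-⊕ : ∀ as as′ (bs : Vec (Q n) k) →
            linComb (as ⊕ as′) bs ≡ linComb as bs ⊕ linComb as′ bs
linComb-⊕ []       []         []       = sym (⊕-self 𝟎)
linComb-⊕ (a ∷ as) (a′ ∷ as′) (b ∷ bs) = begin
  (a xor a′) · b ⊕ linComb (as ⊕ as′) bs
    ≡⟨ cong₂ _⊕_ (·-distribʳ-xor b a a′) (linComb-⊕ as as′ bs) ⟩
  (a · b ⊕ a′ · b) ⊕ (linComb as bs ⊕ linComb as′ bs)
    ≡⟨ ⊕-interchange (a · b) (a′ · b) _ _ ⟩
  (a · b ⊕ linComb as bs) ⊕ (a′ · b ⊕ linComb as′ bs) ∎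
  where open ≡-Reasoning

Span-isSubspace : (bs : Vec (Q n) k) → IsSubspace (Span bs)
Span-isSubspace bs = record
  { 𝟎-mem    = 𝟎-mem
  ; ⊕-closed = λ { (as , refl) (as′ , refl) → as ⊕ as′ , sym (linComb-⊕ as as′ bs) }
  ; ·-closed = λ where
      true  {x} x∈ → subst (Span bs) (sym (true·x≡x x)) x∈
      false {x} x∈ → subst (Span bs) (sym (false·x≡𝟎 x)) 𝟎-mem
  }
  where
  𝟎-mem : 𝟎 ∈ Span bs
  𝟎-mem = 𝟎 , sym (linComb-𝟎 bs)

-- Over 𝔽₂ additivity already amounts to linearity, since the only scalars are 0 and 1; `additive-·`
-- and `additive-linComb` rest on this.
Additive : (Q m → Q n) → Set
Additive f = ∀ x y → f (x ⊕ y) ≡ f x ⊕ f y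

module _ {f : Q m → Q n} (f-⊕ : Additive f) where
  additive-𝟎 : f 𝟎 ≡ 𝟎
  additive-𝟎 = x⊕y≡y⇒x≡𝟎 (f 𝟎) (f 𝟎) (trans (sym (f-⊕ 𝟎 𝟎)) (cong f (⊕-self 𝟎)))

  additive-· : ∀ a x → f (a · x) ≡ a · f x
  additive-· true  x = trans (cong f (true·x≡x x)) (sym (true·x≡x (f x)))
  additive-· false x = trans (cong f (false·x≡𝟎 x)) (trans additive-𝟎 (sym (false·x≡𝟎 (f x))))

  additive-linComb : ∀ as (bs : Vec (Q m) k) → f (linComb as bs) ≡ linComb as (map f bs)
  additive-linComb []       []       = additive-𝟎
  additive-linComb (a ∷ as) (b ∷ bs) =
    trans (f-⊕ _ _) (cong₂ _⊕_ (additive-· a b) (additive-linComb as bs))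

standardBasis : ∀ k → Vec (Q k) k
standardBasis zero    = []
standardBasis (suc k) = (true ∷ 𝟎) ∷ map (false ∷_) (standardBasis k)

linComb-standardBasis : (as : Vec Bool k) → linComb as (standardBasis k) ≡ as
linComb-standardBasis []               = refl
linComb-standardBasis {suc k} (a ∷ as) = begin
  a · (true ∷ 𝟎) ⊕ linComb as (map (false ∷_) (standardBasis k))
    ≡⟨ cong (a · (true ∷ 𝟎) ⊕_) (additive-linComb (λ _ _ → refl) as (standardBasis k)) ⟨
  a · (true ∷ 𝟎) ⊕ (false ∷ linComb as (standardBasis k))
    ≡⟨ cong₂ _∷_ (a∧true-xor-false a) (cong₂ _⊕_ (·-zeroʳ a) (linComb-standardBasis as)) ⟩
  a ∷ 𝟎 ⊕ as
    ≡⟨ cong (a ∷_) (⊕-identityˡ as) ⟩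
  a ∷ as ∎
  where
  open ≡-Reasoning
  a∧true-xor-false : ∀ a → (a ∧ true) xor false ≡ a
  a∧true-xor-false true  = refl
  a∧true-xor-false false = refl

-- Determining sets of coordinates

-- A vector of `Q n` also encodes a set of coordinates, so the same `I` can later serve as a vertex
-- of the cube. For a subspace `C` the condition says that restricting codewords to `I` is
-- injective.
Determines : Q n → Subset n → Set
Determines I C = ∀ {c} → c ∈ C → (∀ {i} → i ∈ᶠ I → lookup c i ≡ false) → c ≡ 𝟎

∣p∪q∣≤∣p∣+∣q∣ : (p q : Q n) → ∣ p ∪ q ∣ ≤ ∣ p ∣ + ∣ q ∣
∣p∪q∣≤∣p∣+∣q∣ []          []          = z≤n
∣p∪q∣≤∣p∣+∣q∣ (false ∷ p) (false ∷ q) = ∣p∪q∣≤∣p∣+∣q∣ p q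
∣p∪q∣≤∣p∣+∣q∣ (false ∷ p) (true  ∷ q) =
  subst (suc ∣ p ∪ q ∣ ≤_) (sym (ℕ.+-suc ∣ p ∣ ∣ q ∣)) (s≤s (∣p∪q∣≤∣p∣+∣q∣ p q))
∣p∪q∣≤∣p∣+∣q∣ (true  ∷ p) (false ∷ q) = s≤s (∣p∪q∣≤∣p∣+∣q∣ p q)
∣p∪q∣≤∣p∣+∣q∣ (true  ∷ p) (true  ∷ q) =
  s≤s (ℕ.≤-trans (∣p∪q∣≤∣p∣+∣q∣ p q) (ℕ.+-monoʳ-≤ ∣ p ∣ (ℕ.n≤1+n ∣ q ∣)))

Span-𝟎∷ : (bs : Vec (Q n) k) → Span (𝟎 ∷ bs) ⊆ Span bs
Span-𝟎∷ bs (a ∷ as , refl) =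
  as , trans (cong (_⊕ linComb as bs) (·-zeroʳ a)) (⊕-identityˡ _)

-- One elimination step, using b as pivot row and i as pivot column.
eliminate : Q n → Fin n → Q n → Q n
eliminate b i x = lookup x i · b ⊕ x

eliminate-⊕ : (b : Q n) → ∀ i → Additive (eliminate b i)
eliminate-⊕ b i x y = begin
  lookup (x ⊕ y) i · b ⊕ (x ⊕ y)
    ≡⟨ cong (λ a → a · b ⊕ (x ⊕ y)) (lookup-zipWith _xor_ i x y) ⟩
  (lookup x i xor lookup y i) · b ⊕ (x ⊕ y)
    ≡⟨ cong (_⊕ (x ⊕ y)) (·-distribʳ-xor b (lookup x i) (lookup y i)) ⟩
  (lookup x i · b ⊕ lookup y i · b) ⊕ (x ⊕ y)
    ≡⟨ ⊕-interchange (lookup x i · b) (lookup y i · b) x y ⟩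
  eliminate b i x ⊕ eliminate b i y ∎
  where open ≡-Reasoning

eliminate-pivot : (b : Q n) → ∀ i → lookup b i ≡ true → eliminate b i b ≡ 𝟎
eliminate-pivot b i bᵢ = begin
  lookup b i · b ⊕ b  ≡⟨ cong (λ a → a · b ⊕ b) bᵢ ⟩
  true · b ⊕ b        ≡⟨ cong (_⊕ b) (true·x≡x b) ⟩
  b ⊕ b               ≡⟨ ⊕-self b ⟩
  𝟎                   ∎
  where open ≡-Reasoning

eliminate-fixes : (b : Q n) → ∀ i x → lookup x i ≡ false → eliminate b i x ≡ x
eliminate-fixes b i x xᵢ = begin
  lookup x i · b ⊕ x  ≡⟨ cong (λ a → a · b ⊕ x) xᵢ ⟩
  false · b ⊕ x       ≡⟨ cong (_⊕ x) (false·x≡𝟎 b) ⟩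
  𝟎 ⊕ x               ≡⟨ ⊕-identityˡ x ⟩
  x                   ∎
  where open ≡-Reasoning

-- A word vanishing at the pivot is fixed by `eliminate b i`. Applying this linear map to its
-- expansion in `b ∷ bs` thus gives the word back, with `b` sent to 𝟎 and `bs` replaced by the
-- reduced rows.
Span-eliminate : (b : Q n) (bs : Vec (Q n) k) → ∀ i → lookup b i ≡ true →
                 ∀ {c} → c ∈ Span (b ∷ bs) → lookup c i ≡ false →
                 c ∈ Span (map (eliminate b i) bs)
Span-eliminate b bs i bᵢ {c} (as , c≡) cᵢ = Span-𝟎∷ (map f bs) (as , (begin
  c                               ≡⟨ eliminate-fixes b i c cᵢ ⟨
  f c                             ≡⟨ cong f c≡ ⟩
  f (linComb as (b ∷ bs))         ≡⟨ additive-linComb (eliminate-⊕ b i) as (b ∷ bs) ⟩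
  linComb as (f b ∷ map f bs)     ≡⟨ cong (λ x → linComb as (x ∷ map f bs)) (eliminate-pivot b i bᵢ) ⟩
  linComb as (𝟎 ∷ map f bs)       ∎))
  where
  open ≡-Reasoning
  f = eliminate b i

-- Induction on the number of generators: a zero generator is dropped, and a nonzero one contributes
-- one pivot coordinate; words vanishing there lie in the span of the reduced remaining generators.
determiningSet : (bs : Vec (Q n) k) → ∃[ I ] ∣ I ∣ ≤ k × Determines I (Span bs)
determiningSet {n} [] = ∅ , ℕ.≤-reflexive (∣⊥∣≡0 n) , λ { ([] , c≡𝟎) _ → c≡𝟎 }
-- Read as a coordinate set, `b` is empty exactly when it is 𝟎; otherwise any coordinate in its
-- support can be the pivot.
determiningSet (b ∷ bs) with nonempty? b
... | no b-empty with refl ← Empty-unique b-empty | I , ∣I∣≤k , det ← determiningSet bs =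
  I , ℕ.m≤n⇒m≤1+n ∣I∣≤k , λ c∈ → det (Span-𝟎∷ bs c∈)
... | yes (i , i∈b) with I , ∣I∣≤k , det ← determiningSet (map (eliminate b i) bs) =
  ⁅ i ⁆ ∪ I , size , λ c∈ c-vanishes →
    det (Span-eliminate b bs i ([]=⇒lookup i∈b) c∈ (c-vanishes (p⊆p∪q I (x∈⁅x⁆ i))))
        (c-vanishes ∘ q⊆p∪q ⁅ i ⁆ I)
  where
  open ≤-Reasoning
  size : ∣ ⁅ i ⁆ ∪ I ∣ ≤ suc _
  size = begin
    ∣ ⁅ i ⁆ ∪ I ∣      ≤⟨ ∣p∪q∣≤∣p∣+∣q∣ ⁅ i ⁆ I ⟩
    ∣ ⁅ i ⁆ ∣ + ∣ I ∣  ≡⟨ cong (_+ ∣ I ∣) (∣⁅x⁆∣≡1 i) ⟩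
    suc ∣ I ∣          ≤⟨ s≤s ∣I∣≤k ⟩
    suc _              ∎

-- The cube

-- The coordinates in which `x` differs from 𝟏 are those outside its support.
hamming-𝟏 : (x : Q n) → hamming 𝟏 x + ∣ x ∣ ≡ n
hamming-𝟏 []          = refl
hamming-𝟏 (false ∷ x) = cong suc (hamming-𝟏 x)
hamming-𝟏 (true  ∷ x) = trans (ℕ.+-suc (hamming 𝟏 x) ∣ x ∣) (cong suc (hamming-𝟏 x))

hamming-refl : (x : Q n) → hamming x x ≡ 0
hamming-refl []          = refl
hamming-refl (false ∷ x) = hamming-refl x
hamming-refl (true  ∷ x) = hamming-refl x

x≼𝟏 : (x : Q n) → x ≼ 𝟏
x≼𝟏 []          = []
x≼𝟏 (false ∷ x) = f≤t ∷ x≼𝟏 x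
x≼𝟏 (true  ∷ x) = b≤b ∷ x≼𝟏 x

𝟏≼x⇒x≡𝟏 : {x : Q n} → 𝟏 ≼ x → x ≡ 𝟏
𝟏≼x⇒x≡𝟏 {x = []}    []          = refl
𝟏≼x⇒x≡𝟏 {x = _ ∷ _} (b≤b ∷ 𝟏≼x) = cong (true ∷_) (𝟏≼x⇒x≡𝟏 𝟏≼x)

-- Wherever `x` is 1, `c` must be 1 too, and adding 𝟏 turns it into 0. This links the covering order
-- to `Determines`.
x≼c⇒𝟏⊕c-vanishes : {x c : Q n} → x ≼ c → ∀ {i} → i ∈ᶠ x → lookup (𝟏 ⊕ c) i ≡ false
x≼c⇒𝟏⊕c-vanishes (b≤b ∷ _)   here        = refl
x≼c⇒𝟏⊕c-vanishes (_   ∷ x≼c) (there i∈x) = x≼c⇒𝟏⊕c-vanishes x≼c i∈x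

-- Covering codes

DownwardCovers-resp-≐ : C ≐ D → DownwardCovers R C → DownwardCovers R D
DownwardCovers-resp-≐ (C⊆D , _) (covers , _) =
  (λ _ → let (c , c∈C) , y∈B = covers tt in (c , C⊆D c∈C) , y∈B) , (λ _ → tt)

IsSubspace-resp-≐ : C ≐ D → IsSubspace C → IsSubspace D
IsSubspace-resp-≐ (C⊆D , D⊆C) C-sub = record
  { 𝟎-mem    = C⊆D 𝟎-mem
  ; ⊕-closed = λ x∈ y∈ → C⊆D (⊕-closed (D⊆C x∈) (D⊆C y∈))
  ; ·-closed = λ a x∈ → C⊆D (·-closed a (D⊆C x∈))
  }
  where open IsSubspace C-sub

IsPlusCode-resp-≐ : C ≐ D → IsPlusCode n R C → IsPlusCode n R D
IsPlusCode-resp-≐ C≐D (C-sub , C-covers) =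
  IsSubspace-resp-≐ C≐D C-sub , DownwardCovers-resp-≐ C≐D C-covers

-- Only 𝟏 lies above 𝟏, so the codeword covering 𝟏 is 𝟏 itself.
covers⇒𝟏∈C : DownwardCovers R C → 𝟏 ∈ C
covers⇒𝟏∈C {C = C} (covers , _) with (c , c∈C) , 𝟏≼c , _ ← covers {𝟏} tt =
  subst C (𝟏≼x⇒x≡𝟏 𝟏≼c) c∈C

-- Adding the codeword 𝟏 maps the subspace into itself and is its own inverse.
plusCode-selfComplementary : IsPlusCode n R C → C ≐ complement C
plusCode-selfComplementary {C = C} (C-sub , C-covers) =
  (λ {x} x∈C → 𝟏 ⊕ x , ⊕-closed 𝟏∈C x∈C , sym (⊕-cancel 𝟏 x)) ,
  (λ { (x , x∈C , refl) → ⊕-closed 𝟏∈C x∈C })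
  where
  open IsSubspace C-sub
  𝟏∈C = covers⇒𝟏∈C {C = C} C-covers

complement-involutive : (C : Subset n) → complement (complement C) ≐ C
complement-involutive C =
  (λ { (_ , (x , x∈C , refl) , refl) → subst C (sym (⊕-cancel 𝟏 x)) x∈C }) ,
  (λ {x} x∈C → 𝟏 ⊕ x , (x , x∈C , refl) , sym (⊕-cancel 𝟏 x))

plus⇒plusMinus : IsPlusCode n R C → IsPlusMinusCode n R C
plus⇒plusMinus C-code = C-code , plusCode-selfComplementary C-code

plus⇒minus : IsPlusCode n R C → IsMinusCode n R C
plus⇒minus C-code = IsPlusCode-resp-≐ (plusCode-selfComplementary C-code) C-code

-- The complement of `C` is a plus code, hence equal to its own complement, and that double
-- complement is `C`.
minus⇒plus : IsMinusCode n R C → IsPlusCode n R C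
minus⇒plus {C = C} C̄-code = IsPlusCode-resp-≐
  (≐-trans (plusCode-selfComplementary C̄-code) (complement-involutive C)) C̄-code

dimension≥1 : n > 0 → IsPlusCode n R C → HasDimension C k → 1 ≤ k
dimension≥1 {k = suc _} _ _ _ = s≤s z≤n
dimension≥1 {n = suc _} {C = C} {k = zero} _ (_ , covers) ([] , _ , C⊆Span , _)
  -- The empty family spans only 𝟎, and 𝟏 differs from 𝟎 in its first coordinate because `n` is
  -- positive.
  with [] , () ← C⊆Span (covers⇒𝟏∈C {C = C} covers)

dimension≥n∸R : IsPlusCode n R C → HasDimension C k → n ∸ R ≤ k
dimension≥n∸R {n} {R} {C} {k} (C-sub , covers) (bs , _ , C⊆Span , _)
  with I , ∣I∣≤k , det ← determiningSet bs
  with (c , c∈C) , I≼c , dist≤R ← proj₁ covers {I} tt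
  -- The codeword `𝟏 ⊕ c` vanishes on `I`, so it is 𝟎 and `c` must be 𝟏.
  with refl ← x⊕y≡𝟎⇒y≡x 𝟏 c
    (det (C⊆Span (IsSubspace.⊕-closed C-sub (covers⇒𝟏∈C {C = C} covers) c∈C))
         (x≼c⇒𝟏⊕c-vanishes I≼c))
  = ℕ.m≤n+o⇒m∸n≤o n R (begin
    n                    ≡⟨ hamming-𝟏 I ⟨
    hamming 𝟏 I + ∣ I ∣  ≤⟨ ℕ.+-mono-≤ dist≤R ∣I∣≤k ⟩
    R + k                ∎)
  where open ≤-Reasoning

-- The optimal code

-- Encoder of the direct sum of 𝔽₂ᵖ and the repetition code of length `suc r`.
encode : ∀ p {r} → Q (suc p) → Q (p + suc r)
encode zero    (a ∷ []) = replicate _ a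
encode (suc p) (a ∷ as) = a ∷ encode p as

encode-⊕ : ∀ p → Additive (encode p {r})
encode-⊕ zero    (a ∷ []) (b ∷ []) = sym (zipWith-replicate _xor_ a b)
encode-⊕ (suc p) (a ∷ as) (b ∷ bs) = cong ((a xor b) ∷_) (encode-⊕ p as bs)

encode-injective : ∀ p {as bs} → encode p {r} as ≡ encode p bs → as ≡ bs
encode-injective zero    {_ ∷ []} {_ ∷ []} eq = cong (_∷ []) (∷-injectiveˡ eq)
encode-injective (suc p) {_ ∷ _}  {_ ∷ _}  eq =
  cong₂ _∷_ (∷-injectiveˡ eq) (encode-injective p (∷-injectiveʳ eq))

-- The first `p` bits are matched exactly, so only the repeated block contributes to the distance: a
-- zero block is covered by zeros, any other block by ones.
encode-covers : ∀ p (x : Q (p + suc r)) → ∃[ as ] x ∈ B⁻ (encode p as) r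
encode-covers {r} zero x with nonempty? x
... | no x-empty with refl ← Empty-unique x-empty =
  false ∷ [] , Pointwise.refl ≤-refl , subst (_≤ r) (sym (hamming-refl x)) z≤n
-- A nonzero block agrees with 𝟏 somewhere, so its distance is strictly below the block length
-- `suc r`, that is, at most `r`.
... | yes (i , i∈x) = true ∷ [] , x≼𝟏 x , s≤s⁻¹ (begin-strict
    hamming 𝟏 x                  ≡⟨ ℕ.+-identityʳ _ ⟨
    hamming 𝟏 x + 0              <⟨ ℕ.+-monoʳ-< (hamming 𝟏 x) 0<∣x∣ ⟩
    hamming 𝟏 x + ∣ x ∣          ≡⟨ hamming-𝟏 x ⟩
    suc r                        ∎)
  where
  open ≤-Reasoning
  0<∣x∣ : 0 < ∣ x ∣
  0<∣x∣ = subst (_≤ ∣ x ∣) (∣⁅x⁆∣≡1 i)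
    (p⊆q⇒∣p∣≤∣q∣ (λ j∈⁅i⁆ → subst (_∈ᶠ x) (sym (x∈⁅y⁆⇒x≡y i j∈⁅i⁆)) i∈x))
encode-covers (suc p) (false ∷ x) with as , x≼c , dist ← encode-covers p x =
  false ∷ as , b≤b ∷ x≼c , dist
encode-covers (suc p) (true ∷ x) with as , x≼c , dist ← encode-covers p x =
  true ∷ as , b≤b ∷ x≼c , dist

-- The code is the image of `encode p`, presented as the span of the encoded standard basis. The
-- combination with coefficients `as` is then `encode p as`, so independence reduces to injectivity.
plusCode-exists : ∀ p {r} → r ≤ R → ∃[ C ] IsPlusCode (p + suc r) R C × HasDimension C (suc p)
plusCode-exists {R} p {r} r≤R =
  Span basis , (Span-isSubspace basis , covers , (λ _ → tt)) , basis , independent , id , id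
  where
  basis : Vec (Q (p + suc r)) (suc p)
  basis = map (encode p) (standardBasis (suc p))

  linComb-basis : ∀ as → linComb as basis ≡ encode p as
  linComb-basis as = trans (sym (additive-linComb (encode-⊕ p) as (standardBasis (suc p))))
                           (cong (encode p) (linComb-standardBasis as))

  covers : ∀ {x} → _ → ∃[ (c , _) ] x ∈ B⁻ c R
  covers {x} _ with as , x≼c , dist ← encode-covers p x =
    (encode p as , as , sym (linComb-basis as)) , x≼c , ℕ.≤-trans dist r≤R

  independent : LinearlyIndependent basis
  independent as eq = encode-injective p
    (trans (sym (linComb-basis as)) (trans eq (sym (additive-𝟎 (encode-⊕ p)))))

1⊔[1+m∸n]≡1+[m∸n] : ∀ m n → 1 ⊔ (suc m ∸ n) ≡ suc (m ∸ n)
1⊔[1+m∸n]≡1+[m∸n] m       zero          = refl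
1⊔[1+m∸n]≡1+[m∸n] zero    (suc zero)    = refl
1⊔[1+m∸n]≡1+[m∸n] zero    (suc (suc _)) = refl
1⊔[1+m∸n]≡1+[m∸n] (suc m) (suc n)       = 1⊔[1+m∸n]≡1+[m∸n] m n

-- With `n = suc m` and `p = m ∸ R`, the repeated block has length `suc (m ∸ p)`, where `m ∸ p` is
-- the minimum of `m` and `R`. This also handles `R ≥ n`, where `p` is 0 and the whole code is a
-- repetition code.
optimalPlusCode : ∀ n R → n > 0 → ∃[ C ] IsPlusCode n R C × HasDimension C (1 ⊔ (n ∸ R))
optimalPlusCode (suc m) R _ =
  subst₂ (λ n k → ∃[ C ] IsPlusCode n R C × HasDimension C k)
    length≡ (sym (1⊔[1+m∸n]≡1+[m∸n] m R))
    (plusCode-exists p (ℕ.m≤n+o⇒m∸n≤o m p (subst (m ≤_) (ℕ.+-comm R p) (ℕ.m≤n+m∸n m R))))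
  where
  p = m ∸ R
  length≡ : p + suc (m ∸ p) ≡ suc m
  length≡ = trans (ℕ.+-suc p (m ∸ p)) (cong suc (ℕ.m+[n∸m]≡n (ℕ.m∸n≤m m R)))

theorem19 : ∀ (n R : ℕ) → n > 0 →
    (k⁺[ n , R ]≡ 1 ⊔ (n ∸ R)) × (k±[ n , R ]≡ 1 ⊔ (n ∸ R)) × (k⁻[ n , R ]≡ 1 ⊔ (n ∸ R))
theorem19 n R n>0 with C , C-code , C-dim ← optimalPlusCode n R n>0 =
  -- One code attains all three minima, and each lower bound reduces to the one for plus codes.
  ((C , C-code , C-dim) , lower) ,
  ((C , plus⇒plusMinus C-code , C-dim) , λ D k (D-code , _) → lower D k D-code) ,
  ((C , plus⇒minus C-code , C-dim) , λ D k D-code → lower D k (minus⇒plus D-code))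
  where
  lower : ∀ D k → IsPlusCode n R D → HasDimension D k → 1 ⊔ (n ∸ R) ≤ k
  lower D k D-code D-dim =
    ℕ.⊔-lub (dimension≥1 n>0 D-code D-dim) (dimension≥n∸R D-code D-dim)
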